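{- Let $k$ be a positive integer, let $\sigma \geq 1$ be a real number with $\sigma k \in \mathbb{N}$, and let $\delta=2+\sigma + \frac{1}{3\sigma}$. Then there exist finite graphs with arbitrarily many vertices whose average degree $\frac{2|E(G)|}{|V(G)|}$ is greater than $\delta k -2$ and which have no $(k+1)$-connected subgraph on more than $(1+\sigma)k$ vertices.
   Context: Graphs are finite and simple. A graph is $(k+1)$-connected if it has more than $k+1$ vertices and remains connected after deleting any set of at most $k$ vertices. -}

module Defs where

open import Data.Nat using (ℕ; _<_; _≤_)
open import Data.Nat.Properties using (_<?_)
open import Data.Bool using (Bool; true; false; T)
open import Data.Bool.Properties using (T?)
open import Data.Fin using (Fin; toℕ)
open import Data.Fin.Subset using (Subset; _∈_; _∉_; _⊆_; ∣_∣)
open import Data.List using (List; length; filter; cartesianProduct; allFin)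
open import Data.Product using (_×_; proj₁; proj₂)
open import Relation.Nullary.Decidable using (_×-dec_)
open import Relation.Binary.PropositionalEquality using (_≡_)

record Graph (n : ℕ) : Set where
  field
    adj    : Fin n → Fin n → Bool
    sym    : ∀ i j → adj i j ≡ adj j i
    irrefl : ∀ i → adj i i ≡ false
open Graph public

edgeCount : ∀ {n} → Graph n → ℕ
edgeCount {n} G =
  length (filter (λ p → (toℕ (proj₁ p) <? toℕ (proj₂ p)) ×-dec T? (adj G (proj₁ p) (proj₂ p)))
                 (cartesianProduct (allFin n) (allFin n)))

record Subgraph {n : ℕ} (G : Graph n) : Set where
  field
    verts  : Subset n
    hadj   : Fin n → Fin n → Bool
    hsym   : ∀ i j → hadj i j ≡ hadj j i
    hsub   : ∀ i j → T (hadj i j) → T (adj G i j) × (i ∈ verts) × (j ∈ verts)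
open Subgraph public

data Reach {n : ℕ} (E : Fin n → Fin n → Bool) (Allowed : Fin n → Set) : Fin n → Fin n → Set where
  here : ∀ {u} → Reach E Allowed u u
  step : ∀ {u v w} → T (E u v) → Allowed v → Reach E Allowed v w → Reach E Allowed u w

ConnectedMinus : ∀ {n} {G : Graph n} → Subgraph G → Subset n → Set
ConnectedMinus H X =
  ∀ u v → u ∈ verts H → u ∉ X → v ∈ verts H → v ∉ X →
    Reach (hadj H) (λ w → (w ∈ verts H) × (w ∉ X)) u v

IsKConnected : ∀ {n} {G : Graph n} → ℕ → Subgraph G → Set
IsKConnected κ H =
  (κ < ∣ verts H ∣) × (∀ X → X ⊆ verts H → ∣ X ∣ < κ → ConnectedMinus H X)

{-# OPTIONS --safe #-}

-- Write m = σ k. Start with a clique on k + m vertices and repeatedly glue two copies of the current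
-- graph along a set of k vertices; no large (k+1)-connected subgraph can straddle such a set. Each
-- gluing set is spread as evenly as possible over all the cliques present, so the number of edges lost
-- to double counting at step j is only about tri k / 2 ^ j. The losses per clique then sum to at most
-- (2/3) tri k ≈ k² / 3, whereas gluing always along k-cliques would lose k² / 2; the difference is the
-- term 1 / (3σ) in δ.
module Submission where

open import Defs hiding (sym)
open import Data.Bool using (Bool; true; false; T; not; _∧_; _≟_)
open import Data.Bool.Properties using (T?; T-∧; ¬-not; ∧-comm)
open import Data.Fin using (Fin; zero; suc; toℕ)
open import Data.Fin.Properties using (any?) renaming (suc-injective to Fin-suc-injective)
open import Data.Fin.Subset using (Subset; _∈_; _∉_; _⊆_; ∣_∣; _∩_; inside; outside)
open import Data.Fin.Subset.Properties using (_∈?_; x∈p∩q⁺; x∈p∩q⁻; p∩q⊆p)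
open import Data.List using (List; []; _∷_; _++_; [_]; map; length; filter; filterᵇ; cartesianProduct; allFin; tabulate; lookup; downFrom; applyDownFrom)
open import Data.List.Properties using (filter-++; length-++; length-map; length-applyDownFrom; map-tabulate; tabulate-lookup; map-∘; map-cong)
open import Data.List.Membership.Propositional using () renaming (_∈_ to _∈ₗ_)
open import Data.List.Membership.Propositional.Properties using (∈-∃++; ∈-lookup; ∈-++⁺ˡ; ∈-++⁺ʳ; ∈-++⁻; ∈-map⁻; ∈-filter⁻)
import Data.List.Relation.Unary.All as All
import Data.List.Relation.Unary.Any as Any
open import Data.List.Relation.Unary.AllPairs using (_∷_)
open import Data.List.Relation.Unary.Unique.Propositional using (Unique)
import Data.List.Relation.Unary.Unique.Propositional.Properties as Unique
open import Data.Maybe using (Maybe; just; nothing; is-nothing)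
open import Data.Maybe.Properties using (≡-dec)
open import Data.Nat using (ℕ; zero; suc; _+_; _*_; _∸_; _^_; _<_; _≤_; z≤n; s≤s; _<ᵇ_; _≤ᵇ_; _≡ᵇ_; ⌊_/2⌋; ⌈_/2⌉)
open import Data.Nat.ListAction using (sum)
open import Data.Nat.Properties hiding (_≟_)
open import Data.Nat.Tactic.RingSolver using (solve-∀)
open import Data.Product using (Σ; ∃; _×_; _,_; proj₁; proj₂)
open import Data.Sum using (_⊎_; inj₁; inj₂)
open import Data.Vec as Vec using (Vec; []; _∷_; head; tail; here; there)
open import Data.Vec.Properties using ([]=⇒lookup; lookup⇒[]=; lookup∘tabulate)
open import Function using (_∘_; id; Equivalence)
open import Relation.Nullary using (¬_; Dec; yes; no; does; contradiction)
open import Relation.Nullary.Decidable using (_×-dec_; dec-true; dec-false)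
open import Relation.Unary using (Decidable)
open import Relation.Binary.PropositionalEquality using (_≡_; _≢_; refl; sym; trans; cong; cong₂; subst; module ≡-Reasoning)
open import Algebra.Properties.CommutativeSemigroup +-commutativeSemigroup using (x∙yz≈y∙xz; interchange)

-- A vertex of an earlier gluing set is shared by several cliques, so every gluing set avoids such
-- vertices. It then meets each clique in fresh slots, with no edges between the parts in different
-- cliques, and the edges it loses can be counted clique by clique. Fresh slots never run out: the
-- initial gluing set takes `k` slots of the only clique, and all later ones together take at most
-- `k` further slots of any one clique. A clique of size `k + m` has room for both as soon as
-- `k ≤ m`, which is the hypothesis σ ≥ 1.
--
-- The loss at step j, at most `tri k / 2 ^ j`, is shared by `2 ^ (j + 1)` cliques. Per clique the
-- losses are thus bounded by a geometric series with first term `tri k / 2` and ratio 1/4, whose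
-- sum is the factor 2/3.

private variable
  A B C D : Set

-- Counting edges of graphs given by lists of vertices

filterᵇ-map : (p : B → Bool) (f : A → B) (xs : List A) →
  filterᵇ p (map f xs) ≡ map f (filterᵇ (p ∘ f) xs)
filterᵇ-map p f [] = refl
filterᵇ-map p f (x ∷ xs) with p (f x)
... | true  = cong (f x ∷_) (filterᵇ-map p f xs)
... | false = filterᵇ-map p f xs

filterᵇ-cong : {p q : A → Bool} → (∀ x → p x ≡ q x) → (xs : List A) → filterᵇ p xs ≡ filterᵇ q xs
filterᵇ-cong p≗q [] = refl
filterᵇ-cong {p = p} {q} p≗q (x ∷ xs) with p x | q x | p≗q x
... | true  | .true  | refl = cong (x ∷_) (filterᵇ-cong p≗q xs)
... | false | .false | refl = filterᵇ-cong p≗q xs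

filterᵇ-false : (xs : List A) → filterᵇ (λ _ → false) xs ≡ []
filterᵇ-false [] = refl
filterᵇ-false (_ ∷ xs) = filterᵇ-false xs

filterᵇ-true : (xs : List A) → filterᵇ (λ _ → true) xs ≡ xs
filterᵇ-true [] = refl
filterᵇ-true (x ∷ xs) = cong (x ∷_) (filterᵇ-true xs)

filterᵇ-++ : (p : A → Bool) (xs ys : List A) → filterᵇ p (xs ++ ys) ≡ filterᵇ p xs ++ filterᵇ p ys
filterᵇ-++ p = filter-++ (T? ∘ p)

filterᵇ-comm : (p q : A → Bool) (xs : List A) → filterᵇ p (filterᵇ q xs) ≡ filterᵇ q (filterᵇ p xs)
filterᵇ-comm p q [] = refl
filterᵇ-comm p q (x ∷ xs) with p x in px | q x in qx
... | true  | true  rewrite px | qx = cong (x ∷_) (filterᵇ-comm p q xs)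
... | true  | false rewrite qx = filterᵇ-comm p q xs
... | false | true  rewrite px = filterᵇ-comm p q xs
... | false | false = filterᵇ-comm p q xs

filterᵇ-absorb : (p q : A → Bool) → (∀ x → p x ≡ true → q x ≡ true) → (xs : List A) →
  filterᵇ p (filterᵇ q xs) ≡ filterᵇ p xs
filterᵇ-absorb p q p⇒q [] = refl
filterᵇ-absorb p q p⇒q (x ∷ xs) with p x in px | q x in qx
... | true  | true  rewrite px = cong (x ∷_) (filterᵇ-absorb p q p⇒q xs)
... | true  | false with () ← trans (sym qx) (p⇒q x px)
... | false | true  rewrite px = filterᵇ-absorb p q p⇒q xs
... | false | false = filterᵇ-absorb p q p⇒q xs

count : (A → Bool) → List A → ℕ
count p xs = length (filterᵇ p xs)

count-++ : (p : A → Bool) (xs ys : List A) → count p (xs ++ ys) ≡ count p xs + count p ys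
count-++ p xs ys = trans (cong length (filter-++ (T? ∘ p) xs ys)) (length-++ (filterᵇ p xs))

count-map : (p : B → Bool) (f : A → B) (xs : List A) → count p (map f xs) ≡ count (p ∘ f) xs
count-map p f xs = trans (cong length (filterᵇ-map p f xs)) (length-map f (filterᵇ (p ∘ f) xs))

count-split : (p q : A → Bool) (xs : List A) →
  count q xs ≡ count q (filterᵇ p xs) + count q (filterᵇ (not ∘ p) xs)
count-split p q [] = refl
count-split p q (x ∷ xs) with p x
count-split p q (x ∷ xs) | true with q x
... | true  = cong suc (count-split p q xs)
... | false = count-split p q xs
count-split p q (x ∷ xs) | false with q x
... | true  = trans (cong suc (count-split p q xs)) (sym (+-suc _ _))
... | false = count-split p q xs

length-split : (p : A → Bool) (xs : List A) →
  length xs ≡ length (filterᵇ p xs) + length (filterᵇ (not ∘ p) xs)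
length-split p [] = refl
length-split p (x ∷ xs) with p x
... | true  = cong suc (length-split p xs)
... | false = trans (cong suc (length-split p xs)) (sym (+-suc _ _))

-- Each pair is counted from its earlier member, so the recursion follows the list and no index
-- comparison is needed.
edges : (A → A → Bool) → List A → ℕ
edges e []       = 0
edges e (x ∷ xs) = count (e x) xs + edges e xs

cross : (A → B → Bool) → List A → List B → ℕ
cross e xs ys = sum (map (λ x → count (e x) ys) xs)

edges-++ : (e : A → A → Bool) (xs ys : List A) →
  edges e (xs ++ ys) ≡ edges e xs + cross e xs ys + edges e ys
edges-++ e [] ys = refl
edges-++ e (x ∷ xs) ys
  rewrite count-++ (e x) xs ys | edges-++ e xs ys
  = lemma (count (e x) xs) (count (e x) ys) (edges e xs) (cross e xs ys) (edges e ys)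
  where
  lemma : ∀ a b c d f → a + b + (c + d + f) ≡ a + c + (b + d) + f
  lemma = solve-∀

cross-++ʳ : (e : A → A → Bool) (xs ys zs : List A) →
  cross e xs (ys ++ zs) ≡ cross e xs ys + cross e xs zs
cross-++ʳ e [] ys zs = refl
cross-++ʳ e (x ∷ xs) ys zs
  rewrite count-++ (e x) ys zs | cross-++ʳ e xs ys zs
  = interchange (count (e x) ys) (count (e x) zs) (cross e xs ys) (cross e xs zs)

cross-∷ʳ : (e : A → A → Bool) → (∀ x y → e x y ≡ e y x) → (xs : List A) (y : A) (ys : List A) →
  cross e xs (y ∷ ys) ≡ count (e y) xs + cross e xs ys
cross-∷ʳ e e-sym [] y ys = refl
cross-∷ʳ e e-sym (x ∷ xs) y ys
  rewrite cross-∷ʳ e e-sym xs y ys | e-sym x y with e y x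
... | true  = cong suc (x∙yz≈y∙xz (count (e x) ys) (count (e y) xs) (cross e xs ys))
... | false = x∙yz≈y∙xz (count (e x) ys) (count (e y) xs) (cross e xs ys)

-- Filtering may move a later entry in front of an earlier one, so a mixed pair can be met in the
-- opposite order; symmetry of `e` repairs this.
edges-split : (e : A → A → Bool) → (∀ x y → e x y ≡ e y x) → (p : A → Bool) (xs : List A) →
  edges e xs ≡ edges e (filterᵇ p xs) + cross e (filterᵇ p xs) (filterᵇ (not ∘ p) xs)
             + edges e (filterᵇ (not ∘ p) xs)
edges-split e e-sym p [] = refl
edges-split e e-sym p (x ∷ xs) with p x
... | true
  rewrite count-split p (e x) xs | edges-split e e-sym p xs
  = lemma (count (e x) (filterᵇ p xs)) (count (e x) (filterᵇ (not ∘ p) xs)) (edges e (filterᵇ p xs)) _ _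
  where
  lemma : ∀ a b c d f → a + b + (c + d + f) ≡ a + c + (b + d) + f
  lemma = solve-∀
... | false
  rewrite count-split p (e x) xs | edges-split e e-sym p xs
        | cross-∷ʳ e e-sym (filterᵇ p xs) x (filterᵇ (not ∘ p) xs)
  = lemma (count (e x) (filterᵇ p xs)) (count (e x) (filterᵇ (not ∘ p) xs)) (edges e (filterᵇ p xs)) _ _
  where
  lemma : ∀ a b c d f → a + b + (c + d + f) ≡ c + (a + d) + (b + f)
  lemma = solve-∀

edges-map : (e : A → A → Bool) (e′ : B → B → Bool) (f : A → B) →
  (∀ x y → e′ (f x) (f y) ≡ e x y) → (xs : List A) → edges e′ (map f xs) ≡ edges e xs
edges-map e e′ f eq [] = refl
edges-map e e′ f eq (x ∷ xs) = cong₂ _+_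
  (trans (count-map (e′ (f x)) f xs) (cong length (filterᵇ-cong (eq x) xs)))
  (edges-map e e′ f eq xs)

cross-map : (e : A → B → Bool) (e′ : C → D → Bool) (f : A → C) (g : B → D) →
  (∀ x y → e′ (f x) (g y) ≡ e x y) → (xs : List A) (ys : List B) →
  cross e′ (map f xs) (map g ys) ≡ cross e xs ys
cross-map e e′ f g eq [] ys = refl
cross-map e e′ f g eq (x ∷ xs) ys = cong₂ _+_
  (trans (count-map (e′ (f x)) g ys) (cong length (filterᵇ-cong (eq x) ys)))
  (cross-map e e′ f g eq xs ys)

cross-map-0 : (e : C → D → Bool) (f : A → C) (g : B → D) →
  (∀ x y → e (f x) (g y) ≡ false) → (xs : List A) (ys : List B) →
  cross e (map f xs) (map g ys) ≡ 0
cross-map-0 e f g eq [] ys = refl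
cross-map-0 e f g eq (x ∷ xs) ys = cong₂ _+_
  (trans (count-map (e (f x)) g ys)
    (cong length (trans (filterᵇ-cong (eq x) ys) (filterᵇ-false ys))))
  (cross-map-0 e f g eq xs ys)

listGraph : (e : A → A → Bool) → (∀ x y → e x y ≡ e y x) → (∀ x → e x x ≡ false) →
  (xs : List A) → Graph (length xs)
listGraph e e-sym e-irrefl xs = record
  { adj    = λ i j → e (lookup xs i) (lookup xs j)
  ; sym    = λ i j → e-sym (lookup xs i) (lookup xs j)
  ; irrefl = λ i → e-irrefl (lookup xs i)
  }

length-filter≡count : {P : A → Set} (P? : Decidable P) (xs : List A) →
  length (filter P? xs) ≡ count (does ∘ P?) xs
length-filter≡count P? [] = refl
length-filter≡count P? (x ∷ xs) with does (P? x)
... | true  = cong suc (length-filter≡count P? xs)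
... | false = length-filter≡count P? xs

length-filter-× : {P : A × B → Set} (P? : Decidable P) (xs : List A) (ys : List B) →
  length (filter P? (cartesianProduct xs ys)) ≡ cross (λ x y → does (P? (x , y))) xs ys
length-filter-× P? [] ys = refl
length-filter-× P? (x ∷ xs) ys = begin
  length (filter P? (map (x ,_) ys ++ cartesianProduct xs ys))
    ≡⟨ cong length (filter-++ P? (map (x ,_) ys) _) ⟩
  length (filter P? (map (x ,_) ys) ++ filter P? (cartesianProduct xs ys))
    ≡⟨ length-++ (filter P? (map (x ,_) ys)) ⟩
  length (filter P? (map (x ,_) ys)) + length (filter P? (cartesianProduct xs ys))
    ≡⟨ cong₂ _+_ (trans (length-filter≡count P? (map (x ,_) ys)) (count-map (does ∘ P?) (x ,_) ys))
                 (length-filter-× P? xs ys) ⟩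
  _ ∎
  where open ≡-Reasoning

count-lookup : (p : A → Bool) (xs : List A) → count (p ∘ lookup xs) (allFin (length xs)) ≡ count p xs
count-lookup p xs = trans (sym (count-map p (lookup xs) (allFin (length xs))))
  (cong (count p) (trans (map-tabulate id (lookup xs)) (tabulate-lookup xs)))

count-tabulate-suc : ∀ {n} (p : Fin (suc n) → Bool) → count p (tabulate suc) ≡ count (p ∘ suc) (allFin n)
count-tabulate-suc {n} p = trans (cong (count p) (sym (map-tabulate id suc))) (count-map p suc (allFin n))

-- This links the index pairs with i < j of `edgeCount` to the list recursion of `edges`: row zero
-- gives the pairs of the head, and the other rows are those of the tail because `suc` preserves the
-- order.
cross-lookup : (e : A → A → Bool) (xs : List A) →
  cross (λ i j → (toℕ i <ᵇ toℕ j) ∧ e (lookup xs i) (lookup xs j)) (allFin (length xs)) (allFin (length xs))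
  ≡ edges e xs
cross-lookup e [] = refl
cross-lookup e (x ∷ xs) = cong₂ _+_
  (trans (count-tabulate-suc (λ j → (0 <ᵇ toℕ j) ∧ e x (lookup (x ∷ xs) j))) (count-lookup (e x) xs))
  (begin
    sum (map row (tabulate suc))
      ≡⟨ cong (sum ∘ map row) (sym (map-tabulate id suc)) ⟩
    sum (map row (map suc (allFin n)))
      ≡⟨ cong sum (sym (map-∘ (allFin n))) ⟩
    sum (map (row ∘ suc) (allFin n))
      -- Column zero vanishes by computation, since `suc i <ᵇ 0` is `false`.
      ≡⟨ cong sum (map-cong (λ i → count-tabulate-suc (entry (suc i))) (allFin n)) ⟩
    sum (map (λ i → count (entry (suc i) ∘ suc) (allFin n)) (allFin n))
      ≡⟨ cross-lookup e xs ⟩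
    edges e xs ∎)
  where
  open ≡-Reasoning
  n = length xs
  entry : Fin (suc n) → Fin (suc n) → Bool
  entry i j = (toℕ i <ᵇ toℕ j) ∧ e (lookup (x ∷ xs) i) (lookup (x ∷ xs) j)
  row : Fin (suc n) → ℕ
  row i = count (entry i) (allFin (suc n))

edgeCount-listGraph : (e : A → A → Bool) (e-sym : ∀ x y → e x y ≡ e y x) (e-irrefl : ∀ x → e x x ≡ false)
  (xs : List A) → edgeCount (listGraph e e-sym e-irrefl xs) ≡ edges e xs
edgeCount-listGraph e e-sym e-irrefl xs = trans (length-filter-× _ (allFin n) (allFin n)) (cross-lookup e xs)
  where n = length xs

-- Triangular numbers and intervals of clique slots

tri : ℕ → ℕ
tri zero    = 0
tri (suc n) = n + tri n

-- `tri n` is n choose 2; this form avoids both division and subtraction.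
2tri+n≡n² : ∀ n → 2 * tri n + n ≡ n * n
2tri+n≡n² zero    = refl
2tri+n≡n² (suc n) = trans (lemma n (tri n)) (trans (cong (_+ (n + suc n)) (2tri+n≡n² n)) (lemma′ n))
  where
  lemma : ∀ n t → 2 * (n + t) + suc n ≡ 2 * t + n + (n + suc n)
  lemma = solve-∀
  lemma′ : ∀ n → n * n + (n + suc n) ≡ suc n * suc n
  lemma′ = solve-∀

-- From n to n + 2 both halves grow by one, which adds 2n on the left and 2n + 1 on the right. This
-- is the source of the geometric decay of the losses.
tri-halves : ∀ n → 2 * (tri ⌊ n /2⌋ + tri ⌈ n /2⌉) ≤ tri n
tri-halves 0 = z≤n
tri-halves 1 = z≤n
tri-halves (suc (suc n)) = begin
  2 * (a + tri a + (b + tri b))       ≡⟨ lemma a b (tri a) (tri b) ⟩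
  2 * (tri a + tri b) + 2 * (a + b)   ≡⟨ cong (λ x → 2 * (tri a + tri b) + 2 * x) (⌊n/2⌋+⌈n/2⌉≡n n) ⟩
  2 * (tri a + tri b) + 2 * n         ≤⟨ +-mono-≤ (tri-halves n) (n≤1+n (2 * n)) ⟩
  tri n + suc (2 * n)                 ≡⟨ lemma′ n (tri n) ⟩
  suc n + (n + tri n)                 ∎
  where
  open ≤-Reasoning
  a = ⌊ n /2⌋
  b = ⌈ n /2⌉
  lemma : ∀ a b s t → 2 * (a + s + (b + t)) ≡ 2 * (s + t) + 2 * (a + b)
  lemma = solve-∀
  lemma′ : ∀ n t → t + suc (2 * n) ≡ suc n + (n + t)
  lemma′ = solve-∀

infix 4 _≢ᵇ_ _≈_

_≢ᵇ_ : ℕ → ℕ → Bool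
i ≢ᵇ j = not (i ≡ᵇ j)

≡ᵇ-sym : ∀ i j → (i ≡ᵇ j) ≡ (j ≡ᵇ i)
≡ᵇ-sym zero    zero    = refl
≡ᵇ-sym zero    (suc j) = refl
≡ᵇ-sym (suc i) zero    = refl
≡ᵇ-sym (suc i) (suc j) = ≡ᵇ-sym i j

≡ᵇ-refl : ∀ i → (i ≡ᵇ i) ≡ true
≡ᵇ-refl zero    = refl
≡ᵇ-refl (suc i) = ≡ᵇ-refl i

>⇒≢ᵇ : ∀ {i j} → j < i → (i ≢ᵇ j) ≡ true
>⇒≢ᵇ {suc i} {zero}  _         = refl
>⇒≢ᵇ {suc i} {suc j} (s≤s j<i) = >⇒≢ᵇ j<i

count-≢ᵇ-slice : ∀ t m n → n ≤ m → count (m + t ≢ᵇ_) (applyDownFrom (_+ t) n) ≡ n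
count-≢ᵇ-slice t m zero    _   = refl
count-≢ᵇ-slice t m (suc n) n<m rewrite >⇒≢ᵇ (+-monoˡ-< t n<m) =
  cong suc (count-≢ᵇ-slice t m n (<⇒≤ n<m))

edges-slice : ∀ t n → edges _≢ᵇ_ (applyDownFrom (_+ t) n) ≡ tri n
edges-slice t zero    = refl
edges-slice t (suc n) = cong₂ _+_ (count-≢ᵇ-slice t n n ≤-refl) (edges-slice t n)

edges-downFrom : ∀ n → edges _≢ᵇ_ (downFrom n) ≡ tri n
edges-downFrom n = trans (cong (edges _≢ᵇ_) (downFrom≡slice n)) (edges-slice 0 n)
  where
  downFrom≡slice : ∀ n → downFrom n ≡ applyDownFrom (_+ 0) n
  downFrom≡slice zero    = refl
  downFrom≡slice (suc n) = cong₂ _∷_ (sym (+-identityʳ n)) (downFrom≡slice n)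

≤ᵇ-true : ∀ {m n} → m ≤ n → (m ≤ᵇ n) ≡ true
≤ᵇ-true {m} {n} = dec-true (m ≤? n)

≤ᵇ-false : ∀ {m n} → n < m → (m ≤ᵇ n) ≡ false
≤ᵇ-false {m} {n} n<m = dec-false (m ≤? n) (<⇒≱ n<m)

filterᵇ-≥-small : ∀ t n → n ≤ t → filterᵇ (t ≤ᵇ_) (downFrom n) ≡ []
filterᵇ-≥-small t zero    _   = refl
filterᵇ-≥-small t (suc n) n<t rewrite ≤ᵇ-false n<t = filterᵇ-≥-small t n (<⇒≤ n<t)

-- Slots are taken from the top, so that what remains is again an initial interval `downFrom t` and
-- the next gluing starts from the same shape.
filterᵇ-≥ : ∀ u t → filterᵇ (t ≤ᵇ_) (downFrom (u + t)) ≡ applyDownFrom (_+ t) u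
filterᵇ-≥ zero    t = filterᵇ-≥-small t t ≤-refl
filterᵇ-≥ (suc u) t rewrite ≤ᵇ-true (m≤n+m t u) = cong (u + t ∷_) (filterᵇ-≥ u t)

filterᵇ-<-small : ∀ t n → n ≤ t → filterᵇ (not ∘ (t ≤ᵇ_)) (downFrom n) ≡ downFrom n
filterᵇ-<-small t zero    _   = refl
filterᵇ-<-small t (suc n) n<t rewrite ≤ᵇ-false n<t = cong (n ∷_) (filterᵇ-<-small t n (<⇒≤ n<t))

filterᵇ-< : ∀ u t → filterᵇ (not ∘ (t ≤ᵇ_)) (downFrom (u + t)) ≡ downFrom t
filterᵇ-< zero    t = filterᵇ-<-small t t ≤-refl
filterᵇ-< (suc u) t rewrite ≤ᵇ-true (m≤n+m t u) = filterᵇ-< u t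

-- Bounding a subset by an injection into a list

∣∣≤length : ∀ {n} (W : Subset n) (f : Fin n → A) (xs : List A) →
  (∀ {i} → i ∈ W → f i ∈ₗ xs) → (∀ {i j} → i ∈ W → j ∈ W → f i ≡ f j → i ≡ j) → ∣ W ∣ ≤ length xs
∣∣≤length [] f xs f∈ f-inj = z≤n
∣∣≤length (outside ∷ W) f xs f∈ f-inj =
  ∣∣≤length W (f ∘ suc) xs (f∈ ∘ there) (λ p q eq → Fin-suc-injective (f-inj (there p) (there q) eq))
∣∣≤length (inside ∷ W) f xs f∈ f-inj with ys , zs , refl ← ∈-∃++ (f∈ here) = begin
  suc ∣ W ∣                    ≤⟨ s≤s (∣∣≤length W (f ∘ suc) (ys ++ zs) f∈′
                                         (λ p q eq → Fin-suc-injective (f-inj (there p) (there q) eq))) ⟩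
  suc (length (ys ++ zs))      ≡⟨ cong suc (length-++ ys) ⟩
  suc (length ys + length zs)  ≡⟨ sym (+-suc (length ys) (length zs)) ⟩
  length ys + suc (length zs)  ≡⟨ sym (length-++ ys) ⟩
  length (ys ++ [ f zero ] ++ zs) ∎
  where
  open ≤-Reasoning
  -- Injectivity keeps all other values in the list after the entry `f zero` is removed.
  f∈′ : ∀ {i} → i ∈ W → f (suc i) ∈ₗ ys ++ zs
  f∈′ p with ∈-++⁻ ys (f∈ (there p))
  ... | inj₁ q = ∈-++⁺ˡ q
  ... | inj₂ (Any.there q) = ∈-++⁺ʳ ys q
  ... | inj₂ (Any.here eq) with () ← f-inj (there p) here eq

lookup-injective : {xs : List A} → Unique xs → ∀ {i j} → lookup xs i ≡ lookup xs j → i ≡ j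
lookup-injective (x∉xs ∷ u) {zero}  {zero}  eq = refl
lookup-injective (x∉xs ∷ u) {zero}  {suc j} eq = contradiction eq (All.lookup x∉xs (∈-lookup j))
lookup-injective (x∉xs ∷ u) {suc i} {zero}  eq = contradiction (sym eq) (All.lookup x∉xs (∈-lookup i))
lookup-injective (x∉xs ∷ u) {suc i} {suc j} eq = cong suc (lookup-injective u eq)

-- Gluing along balanced separators

-- A word records, with the latest gluing first, in which copy a vertex lies; nothing marks a vertex of
-- the gluing set, which belongs to both copies. A vertex is a word together with a slot of the initial
-- clique, and two vertices are adjacent when some clique contains both.
Word : ℕ → Set
Word = Vec (Maybe Bool)

Vertex : ℕ → Set
Vertex j = Word j × ℕ

cons : ∀ {j} → Maybe Bool → Vertex j → Vertex (suc j)
cons h (w , i) = h ∷ w , i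

_≈_ : Maybe Bool → Maybe Bool → Bool
nothing ≈ _       = true
just _  ≈ nothing = true
just a  ≈ just b  = does (a ≟ b)

compat : ∀ {j} → Word j → Word j → Bool
compat []      []      = true
compat (a ∷ w) (b ∷ v) = (a ≈ b) ∧ compat w v

adjacent : ∀ {j} → Vertex j → Vertex j → Bool
adjacent (w , i) (v , l) = compat w v ∧ (i ≢ᵇ l)

≈-sym : ∀ a b → (a ≈ b) ≡ (b ≈ a)
≈-sym nothing      nothing      = refl
≈-sym nothing      (just _)     = refl
≈-sym (just _)     nothing      = refl
≈-sym (just false) (just false) = refl
≈-sym (just false) (just true)  = refl
≈-sym (just true)  (just false) = refl
≈-sym (just true)  (just true)  = refl

compat-sym : ∀ {j} (w v : Word j) → compat w v ≡ compat v w
compat-sym []      []      = refl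
compat-sym (a ∷ w) (b ∷ v) = cong₂ _∧_ (≈-sym a b) (compat-sym w v)

adjacent-sym : ∀ {j} (x y : Vertex j) → adjacent x y ≡ adjacent y x
adjacent-sym (w , i) (v , l) = cong₂ _∧_ (compat-sym w v) (cong not (≡ᵇ-sym i l))

adjacent-irrefl : ∀ {j} (x : Vertex j) → adjacent x x ≡ false
adjacent-irrefl (w , i) rewrite ≡ᵇ-refl i = ∧-comm (compat w w) false

pure : ∀ {j} → Word j → Bool
pure []            = true
pure (nothing ∷ _) = false
pure (just _  ∷ w) = pure w

-- Sum over the words without nothing, that is, over the cliques.
sumW : ∀ j → (Word j → ℕ) → ℕ
sumW zero    g = g []
sumW (suc j) g = sumW j (λ w → g (just false ∷ w) + g (just true ∷ w))

sumW-cong : ∀ j {f g : Word j → ℕ} → (∀ w → pure w ≡ true → f w ≡ g w) → sumW j f ≡ sumW j g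
sumW-cong zero    eq = eq [] refl
sumW-cong (suc j) eq = sumW-cong j (λ w p → cong₂ _+_ (eq (just false ∷ w) p) (eq (just true ∷ w) p))

sumW-mono : ∀ j {f g : Word j → ℕ} → (∀ w → f w ≤ g w) → sumW j f ≤ sumW j g
sumW-mono zero    f≤g = f≤g []
sumW-mono (suc j) f≤g = sumW-mono j (λ w → +-mono-≤ (f≤g (just false ∷ w)) (f≤g (just true ∷ w)))

sumW-+ : ∀ j (f g : Word j → ℕ) → sumW j (λ w → f w + g w) ≡ sumW j f + sumW j g
sumW-+ zero    f g = refl
sumW-+ (suc j) f g = trans
  (sumW-cong j (λ w _ → interchange (f (just false ∷ w)) (g (just false ∷ w)) (f (just true ∷ w)) (g (just true ∷ w))))
  (sumW-+ j _ _)

sumW-*ˡ : ∀ j c (f : Word j → ℕ) → sumW j (λ w → c * f w) ≡ c * sumW j f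
sumW-*ˡ zero    c f = refl
sumW-*ˡ (suc j) c f = trans
  (sumW-cong j (λ w _ → sym (*-distribˡ-+ c (f (just false ∷ w)) (f (just true ∷ w)))))
  (sumW-*ˡ j c _)

-- The order is the one in which `V` lists its two copies, which makes `pool` an equality of lists
-- and not merely one up to permutation.
fam : ∀ j → (Word j → List ℕ) → List (Vertex j)
fam zero    f = map ([] ,_) (f [])
fam (suc j) f = map (cons (just false)) (fam j (λ w → f (just false ∷ w)))
             ++ map (cons (just true)) (fam j (λ w → f (just true ∷ w)))

fam-cong : ∀ j {f g : Word j → List ℕ} → (∀ w → pure w ≡ true → f w ≡ g w) → fam j f ≡ fam j g
fam-cong zero    eq = cong (map ([] ,_)) (eq [] refl)
fam-cong (suc j) eq = cong₂ (λ xs ys → map (cons (just false)) xs ++ map (cons (just true)) ys)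
  (fam-cong j (λ w → eq (just false ∷ w))) (fam-cong j (λ w → eq (just true ∷ w)))

filterᵇ-fam : ∀ j (p : Vertex j → Bool) (f : Word j → List ℕ) →
  filterᵇ p (fam j f) ≡ fam j (λ w → filterᵇ (λ i → p (w , i)) (f w))
filterᵇ-fam zero    p f = filterᵇ-map p ([] ,_) (f [])
filterᵇ-fam (suc j) p f = trans
  (filterᵇ-++ p (map (cons (just false)) (fam j (λ w → f (just false ∷ w)))) _)
  (cong₂ _++_ (copy false) (copy true))
  where
  copy : ∀ b → filterᵇ p (map (cons (just b)) (fam j (λ w → f (just b ∷ w))))
    ≡ map (cons (just b)) (fam j (λ w → filterᵇ (λ i → p (just b ∷ w , i)) (f (just b ∷ w))))
  copy b = trans (filterᵇ-map p (cons (just b)) (fam j (λ w → f (just b ∷ w))))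
    (cong (map (cons (just b))) (filterᵇ-fam j (p ∘ cons (just b)) (λ w → f (just b ∷ w))))

length-fam : ∀ j (f : Word j → List ℕ) → length (fam j f) ≡ sumW j (length ∘ f)
length-fam zero    f = length-map ([] ,_) (f [])
length-fam (suc j) f = begin
  length (map (cons (just false)) xs ++ map (cons (just true)) ys)
    ≡⟨ length-++ (map (cons (just false)) xs) ⟩
  length (map (cons (just false)) xs) + length (map (cons (just true)) ys)
    ≡⟨ cong₂ _+_ (trans (length-map _ xs) (length-fam j _)) (trans (length-map _ ys) (length-fam j _)) ⟩
  sumW j (λ w → length (f (just false ∷ w))) + sumW j (λ w → length (f (just true ∷ w)))
    ≡⟨ sym (sumW-+ j _ _) ⟩
  sumW (suc j) (length ∘ f) ∎
  where
  open ≡-Reasoning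
  xs = fam j (λ w → f (just false ∷ w))
  ys = fam j (λ w → f (just true ∷ w))

-- Two different words without `nothing` disagree at some letter and are incompatible there, so no
-- edge joins different cliques of the family.
edges-fam : ∀ j (f : Word j → List ℕ) → edges adjacent (fam j f) ≡ sumW j (edges _≢ᵇ_ ∘ f)
edges-fam zero    f = edges-map _≢ᵇ_ adjacent ([] ,_) (λ _ _ → refl) (f [])
edges-fam (suc j) f = begin
  edges adjacent (map c₀ xs ++ map c₁ ys)
    ≡⟨ edges-++ adjacent (map c₀ xs) (map c₁ ys) ⟩
  edges adjacent (map c₀ xs) + cross adjacent (map c₀ xs) (map c₁ ys) + edges adjacent (map c₁ ys)
    ≡⟨ cong₂ _+_ (cong₂ _+_ (trans (edges-map adjacent adjacent c₀ (λ _ _ → refl) xs) (edges-fam j _))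
                            (cross-map-0 adjacent c₀ c₁ (λ _ _ → refl) xs ys))
                 (trans (edges-map adjacent adjacent c₁ (λ _ _ → refl) ys) (edges-fam j _)) ⟩
  sumW j (λ w → edges _≢ᵇ_ (f (just false ∷ w))) + 0 + sumW j (λ w → edges _≢ᵇ_ (f (just true ∷ w)))
    ≡⟨ cong (_+ sumW j (λ w → edges _≢ᵇ_ (f (just true ∷ w)))) (+-identityʳ _) ⟩
  sumW j (λ w → edges _≢ᵇ_ (f (just false ∷ w))) + sumW j (λ w → edges _≢ᵇ_ (f (just true ∷ w)))
    ≡⟨ sym (sumW-+ j _ _) ⟩
  sumW (suc j) (edges _≢ᵇ_ ∘ f) ∎
  where
  open ≡-Reasoning
  c₀ = cons {j} (just false)
  c₁ = cons {j} (just true)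
  xs = fam j (λ w → f (just false ∷ w))
  ys = fam j (λ w → f (just true ∷ w))

cons-injective : ∀ {j h} {x y : Vertex j} → cons h x ≡ cons h y → x ≡ y
cons-injective refl = refl

module Construction (k d : ℕ) where

  -- Of the slots of the clique w that lie in no earlier gluing set, the topmost used w go into the next
  -- one and left w + d remain. The two copies of a clique make complementary choices: one gives away
  -- ⌈ p /2⌉ and keeps ⌊ p /2⌋ of its p spare slots, the other vice versa, so that the gluing set has
  -- size k exactly although k need not be a power of 2. The value at nothing is junk.
  left used : ∀ {j} → Word j → ℕ
  left []                = k
  left (nothing ∷ w)     = 0
  left (just false ∷ w)  = ⌊ left w /2⌋
  left (just true ∷ w)   = ⌈ left w /2⌉
  used []                = k
  used (nothing ∷ w)     = 0
  used (just false ∷ w)  = ⌈ left w /2⌉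
  used (just true ∷ w)   = ⌊ left w /2⌋

  rest cap : ∀ {j} → Word j → ℕ
  rest w = left w + d
  cap w  = used w + rest w

  cap-∷ : ∀ {j} b (w : Word j) → cap (just b ∷ w) ≡ rest w
  cap-∷ false w = trans (sym (+-assoc ⌈ left w /2⌉ ⌊ left w /2⌋ d))
    (cong (_+ d) (trans (+-comm ⌈ left w /2⌉ ⌊ left w /2⌋) (⌊n/2⌋+⌈n/2⌉≡n (left w))))
  cap-∷ true  w = trans (sym (+-assoc ⌊ left w /2⌋ ⌈ left w /2⌉ d))
    (cong (_+ d) (⌊n/2⌋+⌈n/2⌉≡n (left w)))

  -- Purity keeps out the vertices of earlier gluing sets. Two pure vertices with different words
  -- are never adjacent, so the gluing set induces a disjoint union of cliques.
  sep : ∀ {j} → Vertex j → Bool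
  sep (w , i) = pure w ∧ (rest w ≤ᵇ i)

  mutual
    V X R : ∀ j → List (Vertex j)
    V zero    = map ([] ,_) (downFrom (cap []))
    V (suc j) = map (cons nothing) (X j) ++ map (cons (just false)) (R j) ++ map (cons (just true)) (R j)
    X j = filterᵇ sep (V j)
    R j = filterᵇ (not ∘ sep) (V j)

  -- The two statements alternate: removing the topmost slots turns `cap` into `rest`, and copying
  -- turns `rest w` into the `cap` of both successors of `w`, while the vertices of `X j` receive
  -- the letter `nothing` and leave the pool.
  pool : ∀ j → filterᵇ (pure ∘ proj₁) (V j) ≡ fam j (downFrom ∘ cap)
  pool-R : ∀ j → filterᵇ (pure ∘ proj₁) (R j) ≡ fam j (downFrom ∘ rest)

  pool zero = trans (filterᵇ-map (pure ∘ proj₁) ([] ,_) (downFrom (cap []))) (cong (map ([] ,_)) (filterᵇ-true _))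
  pool (suc j) = begin
    filterᵇ p (map (cons nothing) (X j) ++ map (cons (just false)) (R j) ++ map (cons (just true)) (R j))
      ≡⟨ trans (filterᵇ-++ p (map (cons nothing) (X j)) _)
               (cong (filterᵇ p (map (cons nothing) (X j)) ++_) (filterᵇ-++ p (map (cons (just false)) (R j)) _)) ⟩
    filterᵇ p (map (cons nothing) (X j)) ++ filterᵇ p (map (cons (just false)) (R j))
                                         ++ filterᵇ p (map (cons (just true)) (R j))
      ≡⟨ cong₂ _++_ (trans (filterᵇ-map p (cons nothing) (X j)) (cong (map (cons nothing)) (filterᵇ-false (X j))))
                    (cong₂ _++_ (copy false) (copy true)) ⟩
    fam (suc j) (downFrom ∘ cap) ∎
    where
    open ≡-Reasoning
    p = pure ∘ proj₁
    copy : ∀ b → filterᵇ p (map (cons (just b)) (R j)) ≡ map (cons (just b)) (fam j (λ w → downFrom (cap (just b ∷ w))))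
    copy b = trans (filterᵇ-map p (cons (just b)) (R j))
      (cong (map (cons (just b))) (trans (pool-R j) (fam-cong j (λ w _ → cong downFrom (sym (cap-∷ b w))))))

  pool-R j = begin
    filterᵇ (pure ∘ proj₁) (R j)
      ≡⟨ filterᵇ-comm (pure ∘ proj₁) (not ∘ sep) (V j) ⟩
    filterᵇ (not ∘ sep) (filterᵇ (pure ∘ proj₁) (V j))
      ≡⟨ cong (filterᵇ (not ∘ sep)) (pool j) ⟩
    filterᵇ (not ∘ sep) (fam j (downFrom ∘ cap))
      ≡⟨ filterᵇ-fam j (not ∘ sep) (downFrom ∘ cap) ⟩
    fam j (λ w → filterᵇ (λ i → not (sep (w , i))) (downFrom (cap w)))
      ≡⟨ fam-cong j (λ w pw → trans
           (filterᵇ-cong (λ i → cong (λ b → not (b ∧ (rest w ≤ᵇ i))) pw) (downFrom (cap w)))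
           (filterᵇ-< (used w) (rest w))) ⟩
    fam j (downFrom ∘ rest) ∎
    where open ≡-Reasoning

  X≡fam : ∀ j → X j ≡ fam j (λ w → applyDownFrom (_+ rest w) (used w))
  X≡fam j = begin
    X j
      ≡⟨ sym (filterᵇ-absorb sep (pure ∘ proj₁) sep⇒pure (V j)) ⟩
    filterᵇ sep (filterᵇ (pure ∘ proj₁) (V j))
      ≡⟨ cong (filterᵇ sep) (pool j) ⟩
    filterᵇ sep (fam j (downFrom ∘ cap))
      ≡⟨ filterᵇ-fam j sep (downFrom ∘ cap) ⟩
    fam j (λ w → filterᵇ (λ i → sep (w , i)) (downFrom (cap w)))
      ≡⟨ fam-cong j (λ w pw → trans
           (filterᵇ-cong (λ i → cong (_∧ (rest w ≤ᵇ i)) pw) (downFrom (cap w)))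
           (filterᵇ-≥ (used w) (rest w))) ⟩
    _ ∎
    where
    open ≡-Reasoning
    sep⇒pure : ∀ x → sep x ≡ true → pure (proj₁ x) ≡ true
    sep⇒pure (w , i) eq with pure w
    ... | true = refl

  -- Sizes and edge counts of the gluing sets and of the glued graph

  -- The two copies of a clique exchange the values of `used` and `left`, so both functions take the
  -- same values equally often. With `g = id` this gives the size of a gluing set, with `g = tri`
  -- its edges.
  sumW-used : ∀ j (g : ℕ → ℕ) → sumW j (λ w → g (used w)) ≡ sumW j (λ w → g (left w))
  sumW-used zero    g = refl
  sumW-used (suc j) g = sumW-cong j (λ w _ → +-comm (g ⌈ left w /2⌉) (g ⌊ left w /2⌋))

  -- The two copies of a clique divide its `left w` spare slots between them, so doubling the number
  -- of cliques leaves the total unchanged.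
  sumW-left : ∀ j → sumW j left ≡ k
  sumW-left zero    = refl
  sumW-left (suc j) = trans (sumW-cong j (λ w _ → ⌊n/2⌋+⌈n/2⌉≡n (left w))) (sumW-left j)

  length-X : ∀ j → length (X j) ≡ k
  length-X j = begin
    length (X j)                   ≡⟨ cong length (X≡fam j) ⟩
    length (fam j _)               ≡⟨ length-fam j _ ⟩
    sumW j (λ w → length (applyDownFrom (_+ rest w) (used w)))
                                   ≡⟨ sumW-cong j (λ w _ → length-applyDownFrom (_+ rest w) (used w)) ⟩
    sumW j used                    ≡⟨ sumW-used j id ⟩
    sumW j left                    ≡⟨ sumW-left j ⟩
    k                              ∎
    where open ≡-Reasoning

  -- By `edges-X` these are the edges inside the gluing set. Written with `left`, which is defined
  -- by halving itself, the sum reduces to `tri-halves` clique by clique.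
  cost : ℕ → ℕ
  cost j = sumW j (tri ∘ left)

  edges-X : ∀ j → edges adjacent (X j) ≡ cost j
  edges-X j = begin
    edges adjacent (X j)                   ≡⟨ cong (edges adjacent) (X≡fam j) ⟩
    edges adjacent (fam j _)               ≡⟨ edges-fam j _ ⟩
    sumW j (λ w → edges _≢ᵇ_ (applyDownFrom (_+ rest w) (used w)))
                                           ≡⟨ sumW-cong j (λ w _ → edges-slice (rest w) (used w)) ⟩
    sumW j (tri ∘ used)                    ≡⟨ sumW-used j tri ⟩
    cost j                                 ∎
    where open ≡-Reasoning

  cost-halves : ∀ j → 2 * cost (suc j) ≤ cost j
  cost-halves j = begin
    2 * cost (suc j)  ≡⟨ sym (sumW-*ˡ j 2 _) ⟩
    sumW j (λ w → 2 * (tri ⌊ left w /2⌋ + tri ⌈ left w /2⌉))  ≤⟨ sumW-mono j (tri-halves ∘ left) ⟩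
    cost j            ∎
    where open ≤-Reasoning

  length-V-suc : ∀ j → length (V (suc j)) + k ≡ 2 * length (V j)
  length-V-suc j = begin
    length (V (suc j)) + k
      ≡⟨ cong₂ _+_ (trans (length-++ (map (cons nothing) (X j))) (cong₂ _+_ (length-map _ (X j))
           (trans (length-++ (map (cons (just false)) (R j))) (cong₂ _+_ (length-map _ (R j)) (length-map _ (R j))))))
           (sym (length-X j)) ⟩
    length (X j) + (length (R j) + length (R j)) + length (X j)
      ≡⟨ lemma (length (X j)) (length (R j)) ⟩
    2 * (length (X j) + length (R j))
      ≡⟨ cong (2 *_) (sym (length-split sep (V j))) ⟩
    2 * length (V j) ∎
    where
    open ≡-Reasoning
    lemma : ∀ x r → x + (r + r) + x ≡ 2 * (x + r)
    lemma = solve-∀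

  -- Edges inside `X j` are the only ones common to both copies: those from `X j` to `R j` occur
  -- once per copy, and none run between the two copies of `R j`.
  edges-V-suc : ∀ j → edges adjacent (V (suc j)) + cost j ≡ 2 * edges adjacent (V j)
  edges-V-suc j = begin
    edges adjacent (V (suc j)) + cost j
      ≡⟨ cong₂ _+_ (edges-++ adjacent (map c* (X j)) (map c₀ (R j) ++ map c₁ (R j))) (sym (edges-X j)) ⟩
    edges adjacent (map c* (X j)) + cross adjacent (map c* (X j)) (map c₀ (R j) ++ map c₁ (R j))
      + edges adjacent (map c₀ (R j) ++ map c₁ (R j)) + edges adjacent (X j)
      ≡⟨ cong (_+ edges adjacent (X j)) (cong₂ _+_ (cong₂ _+_ (same c* (λ _ _ → refl) (X j))
           (trans (cross-++ʳ adjacent (map c* (X j)) (map c₀ (R j)) (map c₁ (R j)))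
             (cong₂ _+_ (cross-map adjacent adjacent c* c₀ (λ _ _ → refl) (X j) (R j))
                        (cross-map adjacent adjacent c* c₁ (λ _ _ → refl) (X j) (R j)))))
           (trans (edges-++ adjacent (map c₀ (R j)) (map c₁ (R j)))
             (cong₂ _+_ (cong₂ _+_ (same c₀ (λ _ _ → refl) (R j))
                                   (cross-map-0 adjacent c₀ c₁ (λ _ _ → refl) (R j) (R j)))
                        (same c₁ (λ _ _ → refl) (R j))))) ⟩
    _ ≡⟨ lemma (edges adjacent (X j)) (cross adjacent (X j) (R j)) (edges adjacent (R j)) ⟩
    2 * (edges adjacent (X j) + cross adjacent (X j) (R j) + edges adjacent (R j))
      ≡⟨ cong (2 *_) (sym (edges-split adjacent adjacent-sym sep (V j))) ⟩
    2 * edges adjacent (V j) ∎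
    where
    open ≡-Reasoning
    c* = cons {j} nothing
    c₀ = cons {j} (just false)
    c₁ = cons {j} (just true)
    same : (c : Vertex j → Vertex (suc j)) → (∀ x y → adjacent (c x) (c y) ≡ adjacent x y) →
      ∀ xs → edges adjacent (map c xs) ≡ edges adjacent xs
    same = edges-map adjacent adjacent
    lemma : ∀ x c r → x + (c + c) + (r + 0 + r) + x ≡ 2 * (x + c + r)
    lemma = solve-∀

  length-V : ∀ j → length (V j) ≡ 2 ^ j * (k + d) + k
  length-V zero = trans (length-map ([] ,_) (downFrom (cap []))) (trans (length-applyDownFrom id (cap [])) (lemma k d))
    where
    lemma : ∀ k d → k + (k + d) ≡ 1 * (k + d) + k
    lemma = solve-∀
  length-V (suc j) = +-cancelʳ-≡ k _ _ (begin
    length (V (suc j)) + k             ≡⟨ length-V-suc j ⟩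
    2 * length (V j)                   ≡⟨ cong (2 *_) (length-V j) ⟩
    2 * (2 ^ j * (k + d) + k)          ≡⟨ lemma (2 ^ j) (k + d) k ⟩
    2 * 2 ^ j * (k + d) + k + k        ∎)
    where
    open ≡-Reasoning
    lemma : ∀ L m k → 2 * (L * m + k) ≡ 2 * L * m + k + k
    lemma = solve-∀

  edges-V₀ : edges adjacent (V 0) ≡ tri (k + (k + d))
  edges-V₀ = trans (edges-map _≢ᵇ_ adjacent ([] ,_) (λ _ _ → refl) (downFrom (cap [])))
    (edges-downFrom (cap []))

  -- By cost-halves, 3 edges − 2 cost at least doubles at each step; terms are moved to avoid subtraction.
  edges-V-bound : ∀ j → 2 ^ j * (3 * tri (k + (k + d))) + 2 * cost j ≤ 3 * edges adjacent (V j) + 2 ^ j * (2 * tri k)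
  edges-V-bound zero = ≤-reflexive (cong₂ _+_ (trans (*-identityˡ _) (cong (3 *_) (sym edges-V₀))) (sym (*-identityˡ (2 * tri k))))
  edges-V-bound (suc j) = +-cancelʳ-≤ (3 * cost j) _ _ (begin
    2 * L * (3 * E₀) + 2 * cost (suc j) + 3 * cost j
      ≤⟨ +-monoˡ-≤ (3 * cost j) (+-monoʳ-≤ (2 * L * (3 * E₀)) (cost-halves j)) ⟩
    -- The gluing loses `3 * cost j`, and `2 * cost (suc j)` is at most another `cost j`; together
    -- they are twice `2 * cost j`, which explains the weight 2 against 3.
    2 * L * (3 * E₀) + cost j + 3 * cost j
      ≡⟨ lemma L E₀ (cost j) ⟩
    2 * (L * (3 * E₀) + 2 * cost j)
      ≤⟨ *-monoʳ-≤ 2 (edges-V-bound j) ⟩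
    2 * (3 * e + L * (2 * tri k))
      ≡⟨ lemma′ L e (tri k) ⟩
    3 * (2 * e) + 2 * L * (2 * tri k)
      ≡⟨ cong (λ x → 3 * x + 2 * L * (2 * tri k)) (sym (edges-V-suc j)) ⟩
    3 * (e′ + cost j) + 2 * L * (2 * tri k)
      ≡⟨ lemma″ e′ (cost j) (2 * L * (2 * tri k)) ⟩
    3 * e′ + 2 * L * (2 * tri k) + 3 * cost j ∎)
    where
    open ≤-Reasoning
    L  = 2 ^ j
    E₀ = tri (k + (k + d))
    e  = edges adjacent (V j)
    e′ = edges adjacent (V (suc j))
    lemma : ∀ L E c → 2 * L * (3 * E) + c + 3 * c ≡ 2 * (L * (3 * E) + 2 * c)
    lemma = solve-∀
    lemma′ : ∀ L e t → 2 * (3 * e + L * (2 * t)) ≡ 3 * (2 * e) + 2 * L * (2 * t)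
    lemma′ = solve-∀
    lemma″ : ∀ e c y → 3 * (e + c) + y ≡ 3 * e + y + 3 * c
    lemma″ = solve-∀

  -- Highly connected vertex sets are small

  ∈-V-suc : ∀ {j} {z : Vertex (suc j)} → z ∈ₗ V (suc j) →
    (∃ λ x → x ∈ₗ X j × z ≡ cons nothing x) ⊎ (∃ λ b → ∃ λ x → x ∈ₗ R j × z ≡ cons (just b) x)
  ∈-V-suc {j} z∈ with ∈-++⁻ (map (cons nothing) (X j)) z∈
  ... | inj₁ p = inj₁ (∈-map⁻ (cons nothing) p)
  ... | inj₂ p with ∈-++⁻ (map (cons (just false)) (R j)) p
  ... | inj₁ q = inj₂ (false , ∈-map⁻ (cons (just false)) q)
  ... | inj₂ q = inj₂ (true  , ∈-map⁻ (cons (just true)) q)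

  X⊆V : ∀ {j} {x : Vertex j} → x ∈ₗ X j → x ∈ₗ V j
  X⊆V {j} = proj₁ ∘ ∈-filter⁻ (T? ∘ sep) {xs = V j}

  R⊆V : ∀ {j} {x : Vertex j} → x ∈ₗ R j → x ∈ₗ V j
  R⊆V {j} = proj₁ ∘ ∈-filter⁻ (T? ∘ not ∘ sep) {xs = V j}

  X∩R : ∀ {j} {x : Vertex j} → x ∈ₗ X j → ¬ (x ∈ₗ R j)
  X∩R {j} {x} p q
    with sep x | proj₂ (∈-filter⁻ (T? ∘ sep) {xs = V j} p) | proj₂ (∈-filter⁻ (T? ∘ not ∘ sep) {xs = V j} q)
  ... | true  | _ | ()
  ... | false | () | _

  V-unique : ∀ j → Unique (V j)
  V-unique zero    = Unique.map⁺ (λ { refl → refl }) (Unique.downFrom⁺ _)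
  V-unique (suc j) = Unique.++⁺ (copy nothing X-unique)
    (Unique.++⁺ (copy (just false) R-unique) (copy (just true) R-unique) disj₁) disj₂
    where
    X-unique = Unique.filter⁺ (T? ∘ sep) (V-unique j)
    R-unique = Unique.filter⁺ (T? ∘ not ∘ sep) (V-unique j)
    copy : ∀ h {xs : List (Vertex j)} → Unique xs → Unique (map (cons h) xs)
    copy h = Unique.map⁺ cons-injective
    disj₁ : ∀ {z} → ¬ (z ∈ₗ map (cons (just false)) (R j) × z ∈ₗ map (cons (just true)) (R j))
    disj₁ (p , q) with ∈-map⁻ (cons (just false)) p | ∈-map⁻ (cons (just true)) q
    ... | _ , _ , refl | _ , _ , ()
    disj₂ : ∀ {z} → ¬ (z ∈ₗ map (cons nothing) (X j) ×
                       z ∈ₗ map (cons (just false)) (R j) ++ map (cons (just true)) (R j))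
    disj₂ (p , q) with ∈-map⁻ (cons nothing) p | ∈-++⁻ (map (cons (just false)) (R j)) q
    ... | _ , _ , refl | inj₁ r with () ← proj₂ (proj₂ (∈-map⁻ (cons (just false)) r))
    ... | _ , _ , refl | inj₂ r with () ← proj₂ (proj₂ (∈-map⁻ (cons (just true)) r))

  -- If W meets both copies of the last gluing, its vertices in the gluing set separate it; otherwise
  -- it lies in one copy, and dropping the first letter of the words is injective on it.
  connected⇒small : ∀ j {n} (W : Subset n) (E : Fin n → Fin n → Bool) →
    (∀ Y → Y ⊆ W → ∣ Y ∣ < k + 1 → ∀ u v → u ∈ W → u ∉ Y → v ∈ W → v ∉ Y →
      Reach E (λ w → (w ∈ W) × (w ∉ Y)) u v) →
    (x : Fin n → Vertex j) →
    (∀ {u v} → T (E u v) → T (compat (proj₁ (x u)) (proj₁ (x v)))) →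
    (∀ {u} → u ∈ W → x u ∈ₗ V j) →
    (∀ {u v} → u ∈ W → v ∈ W → x u ≡ x v → u ≡ v) →
    ∣ W ∣ ≤ k + (k + d)
  connected⇒small zero W E conn x hom x∈V x-inj = subst (∣ W ∣ ≤_)
    (trans (length-map ([] ,_) (downFrom (k + (k + d)))) (length-applyDownFrom id (k + (k + d))))
    (∣∣≤length W x (V 0) x∈V x-inj)
  connected⇒small (suc j) {n} W E conn x hom x∈V x-inj = split (side? false) (side? true)
    where
    h : Fin n → Maybe Bool
    h u = head (proj₁ (x u))
    y : Fin n → Vertex j
    y u = tail (proj₁ (x u)) , proj₂ (x u)

    cons-h-y : ∀ u → cons (h u) (y u) ≡ x u
    cons-h-y u with x u
    ... | _ ∷ _ , _ = refl

    x-cases : ∀ {u} → u ∈ W → (h u ≡ nothing × y u ∈ₗ X j) ⊎ (∃ λ b → h u ≡ just b × y u ∈ₗ R j)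
    x-cases {u} u∈W with x u | ∈-V-suc (x∈V u∈W)
    ... | _ | inj₁ (_ , p , refl)     = inj₁ (refl , p)
    ... | _ | inj₂ (b , _ , p , refl) = inj₂ (b , refl , p)

    y∈V : ∀ {u} → u ∈ W → y u ∈ₗ V j
    y∈V u∈W with x-cases u∈W
    ... | inj₁ (_ , p)     = X⊆V p
    ... | inj₂ (_ , _ , p) = R⊆V p

    hom-h : ∀ {u v} → T (E u v) → T (h u ≈ h v) × T (compat (proj₁ (y u)) (proj₁ (y v)))
    hom-h {u} {v} e = Equivalence.to T-∧ (subst T (lemma (proj₁ (x u)) (proj₁ (x v))) (hom e))
      where
      lemma : (w w′ : Word (suc j)) → compat w w′ ≡ (head w ≈ head w′) ∧ compat (tail w) (tail w′)
      lemma (_ ∷ _) (_ ∷ _) = refl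

    side? : ∀ b → Dec (∃ λ u → u ∈ W × h u ≡ just b)
    side? b = any? (λ u → (u ∈? W) ×-dec ≡-dec _≟_ (h u) (just b))

    star : Subset n
    star = Vec.tabulate (is-nothing ∘ h)

    ∈-star⁺ : ∀ {u} → h u ≡ nothing → u ∈ star
    ∈-star⁺ {u} eq = lookup⇒[]= u star (trans (lookup∘tabulate _ u) (cong is-nothing eq))

    ∈-star⁻ : ∀ {u} → u ∈ star → h u ≡ nothing
    ∈-star⁻ {u} p with h u | trans (sym (lookup∘tabulate (is-nothing ∘ h) u)) ([]=⇒lookup p)
    ... | nothing | _ = refl

    separator : Subset n
    separator = W ∩ star

    ∣separator∣≤k : ∣ separator ∣ ≤ k
    ∣separator∣≤k = subst (∣ separator ∣ ≤_) (length-X j) (∣∣≤length separator y (X j) in-X inj)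
      where
      in-X : ∀ {u} → u ∈ separator → y u ∈ₗ X j
      in-X p with u∈W , u∈star ← x∈p∩q⁻ W star p with x-cases u∈W
      ... | inj₁ (_ , q) = q
      ... | inj₂ (_ , eq , _) with () ← trans (sym eq) (∈-star⁻ u∈star)
      inj : ∀ {u v} → u ∈ separator → v ∈ separator → y u ≡ y v → u ≡ v
      inj {u} {v} p q eq with u∈W , u∈star ← x∈p∩q⁻ W star p | v∈W , v∈star ← x∈p∩q⁻ W star q =
        x-inj u∈W v∈W (trans (sym (cons-h-y u))
          (trans (cong₂ cons (trans (∈-star⁻ u∈star) (sym (∈-star⁻ v∈star))) eq) (cons-h-y v)))

    ∉-separator : ∀ {u b} → h u ≡ just b → u ∉ separator
    ∉-separator eq p with () ← trans (sym eq) (∈-star⁻ (proj₂ (x∈p∩q⁻ W star p)))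

    reach-side : ∀ {u v b} → h u ≡ just b → Reach E (λ w → (w ∈ W) × (w ∉ separator)) u v → h v ≡ just b
    reach-side eq here = eq
    reach-side {b = b} eq (step {v = w} e (w∈W , w∉) r) = reach-side (same (h w) refl) r
      where
      same : ∀ c → h w ≡ c → c ≡ just b
      -- `nothing` is compatible with both letters, so a walk can change sides only at such a
      -- vertex, and the separator contains all of those in `W`.
      same nothing  hw = contradiction (x∈p∩q⁺ (w∈W , ∈-star⁺ hw)) w∉
      same (just c) hw with b ≟ c | subst T (cong₂ _≈_ eq hw) (proj₁ (hom-h e))
      ... | yes refl | _ = refl
      ... | no _     | ()

    one-sided : ∀ b → (∀ {u} → u ∈ W → h u ≢ just b) → ∣ W ∣ ≤ k + (k + d)
    -- Only the labelling changes: `W`, `E` and the connectivity hypothesis pass to the induction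
    -- unaltered, because the labelling is asked merely to send edges to compatible words.
    one-sided b not-b = connected⇒small j W E conn y (proj₂ ∘ hom-h) y∈V y-inj
      where
      h-eq : ∀ {u v} → u ∈ W → v ∈ W → y u ≡ y v → h u ≡ h v
      h-eq u∈W v∈W eq with x-cases u∈W | x-cases v∈W
      ... | inj₁ (hu , _) | inj₁ (hv , _) = trans hu (sym hv)
      ... | inj₁ (_ , p)  | inj₂ (_ , _ , q) = contradiction q (X∩R (subst (_∈ₗ X j) eq p))
      ... | inj₂ (_ , _ , p) | inj₁ (_ , q) = contradiction (subst (_∈ₗ R j) eq p) (X∩R q)
      ... | inj₂ (c , hu , _) | inj₂ (c′ , hv , _) = trans hu (trans (cong just (trans
              (¬-not {y = b} (λ { refl → not-b u∈W hu })) (sym (¬-not {y = b} (λ { refl → not-b v∈W hv }))))) (sym hv))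
      y-inj : ∀ {u v} → u ∈ W → v ∈ W → y u ≡ y v → u ≡ v
      y-inj {u} {v} u∈W v∈W eq = x-inj u∈W v∈W
        (trans (sym (cons-h-y u)) (trans (cong₂ cons (h-eq u∈W v∈W eq) eq) (cons-h-y v)))

    split : Dec (∃ λ u → u ∈ W × h u ≡ just false) → Dec (∃ λ u → u ∈ W × h u ≡ just true) →
      ∣ W ∣ ≤ k + (k + d)
    split (no ¬p) _ = one-sided false (λ u∈W eq → ¬p (_ , u∈W , eq))
    split _ (no ¬q) = one-sided true (λ u∈W eq → ¬q (_ , u∈W , eq))
    split (yes (u , u∈W , hu)) (yes (v , v∈W , hv))
      with () ← trans (sym hv) (reach-side hu (conn separator (p∩q⊆p W star)
             (subst (∣ separator ∣ <_) (+-comm 1 k) (s≤s ∣separator∣≤k))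
             u v u∈W (∉-separator hu) v∈W (∉-separator hv)))

-- The numerical estimate

n<2^n : ∀ n → n < 2 ^ n
n<2^n zero    = s≤s z≤n
n<2^n (suc n) = begin-strict
  suc n          ≤⟨ n<2^n n ⟩
  2 ^ n          <⟨ m<m+n (2 ^ n) (≤-trans (≤-trans (s≤s z≤n) (n<2^n n)) (m≤m+n (2 ^ n) 0)) ⟩
  2 ^ suc n      ∎
  where open ≤-Reasoning

edge-bound : ∀ k m L n e s t D → 1 ≤ k → k ≤ m → n ≡ L * m + k →
  2 * s + (k + m) ≡ (k + m) * (k + m) → 2 * t + k ≡ k * k → L * (3 * s) ≤ 3 * e + L * (2 * t) →
  D + 6 * m ≡ 6 * k * m + 3 * m * m + k * k → (6 * k * m + 3 * m * m + k * k) * k < L →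
  D * n < 6 * m * e
edge-bound k m L n e s t D 1≤k k≤m refl s-eq t-eq bound D-eq Qk<L = +-cancelʳ-< (6 * m * n) _ _ (begin-strict
  D * n + 6 * m * n                   ≡⟨ sym (*-distribʳ-+ n D (6 * m)) ⟩
  (D + 6 * m) * n                     ≡⟨ cong (_* n) D-eq ⟩
  Q * (L * m + k)                     ≡⟨ lemma₁ Q L m k ⟩
  m * L * Q + Q * k                   <⟨ +-mono-≤-< main Qk<L ⟩
  -- Out of the available `6 * m * m * L`, four parts cover `m * L * (k + 3 * m)` and one covers
  -- `L`, which dominates the contribution `Q * k` of the additional vertices.
  6 * m * e + m * L * (k + 3 * m) + L ≤⟨ +-mono-≤ (+-monoʳ-≤ (6 * m * e) (*-monoʳ-≤ (m * L) (+-monoˡ-≤ (3 * m) k≤m)))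
                                                  (subst (_≤ m * m * L) (*-identityˡ L) (*-monoˡ-≤ L (*-mono-≤ 1≤m 1≤m))) ⟩
  6 * m * e + m * L * (m + 3 * m) + m * m * L
                                      ≤⟨ m≤m+n _ (m * m * L + 6 * m * k) ⟩
  6 * m * e + m * L * (m + 3 * m) + m * m * L + (m * m * L + 6 * m * k)
                                      ≡⟨ lemma₂ m e L k ⟩
  6 * m * e + 6 * m * (L * m + k)     ∎)
  where
  open ≤-Reasoning
  Q = 6 * k * m + 3 * m * m + k * k
  1≤m = ≤-trans 1≤k k≤m
  lemma₁ : ∀ Q L m k → Q * (L * m + k) ≡ m * L * Q + Q * k
  lemma₁ = solve-∀
  lemma₂ : ∀ m e L k → 6 * m * e + m * L * (m + 3 * m) + m * m * L + (m * m * L + 6 * m * k)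
    ≡ 6 * m * e + 6 * m * (L * m + k)
  lemma₂ = solve-∀
  lemma₃ : ∀ k m L → m * L * (6 * k * m + 3 * m * m + k * k) + (2 * m * L * (k * k) + 2 * m * L * k)
    ≡ 3 * m * L * ((k + m) * (k + m)) + 2 * m * L * k
  lemma₃ = solve-∀
  lemma₄ : ∀ k m L s → 3 * m * L * (2 * s + (k + m)) + 2 * m * L * k
    ≡ 2 * m * (L * (3 * s)) + (3 * m * L * (k + m) + 2 * m * L * k)
  lemma₄ = solve-∀
  lemma₅ : ∀ k m L e t → 2 * m * (3 * e + L * (2 * t)) + (3 * m * L * (k + m) + 2 * m * L * k)
    ≡ 6 * m * e + 2 * m * L * (2 * t + k) + 3 * m * L * (k + m)
  lemma₅ = solve-∀
  lemma₆ : ∀ k m L e → 6 * m * e + 2 * m * L * (k * k) + 3 * m * L * (k + m)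
    ≡ 6 * m * e + m * L * (k + 3 * m) + (2 * m * L * (k * k) + 2 * m * L * k)
  lemma₆ = solve-∀
  -- The quadratic terms match because `Q + 2 * k * k` equals `3 * (k + m) * (k + m)`. The summands
  -- added on both sides replace the subtractions.
  main : m * L * Q ≤ 6 * m * e + m * L * (k + 3 * m)
  main = +-cancelʳ-≤ (2 * m * L * (k * k) + 2 * m * L * k) _ _ (begin
    m * L * Q + (2 * m * L * (k * k) + 2 * m * L * k)
      ≡⟨ lemma₃ k m L ⟩
    3 * m * L * ((k + m) * (k + m)) + 2 * m * L * k
      ≡⟨ cong (λ x → 3 * m * L * x + 2 * m * L * k) (sym s-eq) ⟩
    3 * m * L * (2 * s + (k + m)) + 2 * m * L * k
      ≡⟨ lemma₄ k m L s ⟩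
    2 * m * (L * (3 * s)) + (3 * m * L * (k + m) + 2 * m * L * k)
      ≤⟨ +-monoˡ-≤ _ (*-monoʳ-≤ (2 * m) bound) ⟩
    2 * m * (3 * e + L * (2 * t)) + (3 * m * L * (k + m) + 2 * m * L * k)
      ≡⟨ lemma₅ k m L e t ⟩
    6 * m * e + 2 * m * L * (2 * t + k) + 3 * m * L * (k + m)
      ≡⟨ cong (λ x → 6 * m * e + 2 * m * L * x + 3 * m * L * (k + m)) t-eq ⟩
    6 * m * e + 2 * m * L * (k * k) + 3 * m * L * (k + m)
      ≡⟨ lemma₆ k m L e ⟩
    6 * m * e + m * L * (k + 3 * m) + (2 * m * L * (k * k) + 2 * m * L * k) ∎)

-- With m = σk, δk - 2 equals (6km + 3m² + k² - 6m) / (3m), so the strict inequality is the bound on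
-- 2|E|/|V| cleared of denominators. The truncated subtraction is exact by `6m≤Q`.
theorem2 : (k m : ℕ) → 1 ≤ k → k ≤ m → (N : ℕ) →
    Σ ℕ λ n → (N ≤ n) × Σ (Graph n) λ G →
    (((6 * k * m + 3 * m * m + k * k) ∸ 6 * m) * n < 6 * m * edgeCount G)
    × ((H : Subgraph G) → k + m < ∣ verts H ∣ → ¬ IsKConnected (k + 1) H)
theorem2 k m 1≤k k≤m N = n , N≤n , G , dense , no-large
  where
  d = m ∸ k
  open Construction k d
  m-eq : k + d ≡ m
  m-eq = m+[n∸m]≡n k≤m
  Q = 6 * k * m + 3 * m * m + k * k
  -- Since `2 ^ J` exceeds `J`, this exponent secures both `N ≤ n` and the condition `Q * k < 2 ^ J`
  -- of `edge-bound`.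
  J = N + Q * k
  n = length (V J)
  G : Graph n
  G = listGraph adjacent adjacent-sym adjacent-irrefl (V J)
  n-eq : n ≡ 2 ^ J * m + k
  n-eq = trans (length-V J) (cong (λ x → 2 ^ J * x + k) m-eq)
  1≤m : 1 ≤ m
  1≤m = ≤-trans 1≤k k≤m
  N≤n : N ≤ n
  N≤n = begin
    N              ≤⟨ m≤m+n N (Q * k) ⟩
    J              ≤⟨ <⇒≤ (n<2^n J) ⟩
    2 ^ J          ≡⟨ sym (*-identityʳ (2 ^ J)) ⟩
    2 ^ J * 1      ≤⟨ *-monoʳ-≤ (2 ^ J) 1≤m ⟩
    2 ^ J * m      ≤⟨ m≤m+n (2 ^ J * m) k ⟩
    2 ^ J * m + k  ≡⟨ sym n-eq ⟩
    n              ∎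
    where open ≤-Reasoning
  6m≤Q : 6 * m ≤ Q
  6m≤Q = begin
    6 * m                  ≤⟨ *-monoˡ-≤ m (*-monoʳ-≤ 6 1≤k) ⟩
    6 * k * m              ≤⟨ m≤m+n (6 * k * m) (3 * m * m) ⟩
    6 * k * m + 3 * m * m  ≤⟨ m≤m+n _ (k * k) ⟩
    Q                      ∎
    where open ≤-Reasoning
  bound : 2 ^ J * (3 * tri (k + m)) ≤ 3 * edgeCount G + 2 ^ J * (2 * tri k)
  bound = begin
    2 ^ J * (3 * tri (k + m))        ≡⟨ cong (λ x → 2 ^ J * (3 * tri (k + x))) (sym m-eq) ⟩
    2 ^ J * (3 * tri (k + (k + d)))  ≤⟨ m≤m+n _ (2 * cost J) ⟩
    2 ^ J * (3 * tri (k + (k + d))) + 2 * cost J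
                                     ≤⟨ edges-V-bound J ⟩
    3 * edges adjacent (V J) + 2 ^ J * (2 * tri k)
      ≡⟨ cong (λ x → 3 * x + 2 ^ J * (2 * tri k)) (sym (edgeCount-listGraph adjacent adjacent-sym adjacent-irrefl (V J))) ⟩
    3 * edgeCount G + 2 ^ J * (2 * tri k) ∎
    where open ≤-Reasoning
  dense : (Q ∸ 6 * m) * n < 6 * m * edgeCount G
  dense = edge-bound k m (2 ^ J) n (edgeCount G) (tri (k + m)) (tri k) (Q ∸ 6 * m) 1≤k k≤m n-eq
    (2tri+n≡n² (k + m)) (2tri+n≡n² k) bound (m∸n+n≡m 6m≤Q)
    (≤-<-trans (m≤n+m (Q * k) N) (n<2^n J))
  no-large : (H : Subgraph G) → k + m < ∣ verts H ∣ → ¬ IsKConnected (k + 1) H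
  no-large H large (_ , connected) = <⇒≱ large (subst (λ x → ∣ verts H ∣ ≤ k + x) m-eq
    (connected⇒small J (verts H) (hadj H) connected (lookup (V J))
      (λ {u} {v} e → proj₁ (Equivalence.to T-∧ (proj₁ (hsub H u v e))))
      (λ {u} _ → ∈-lookup u)
      (λ _ _ → lookup-injective (V-unique J))))
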